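{- Let $\mathcal{L}$ be a block diagram language with compositional semantics $[\![\cdot]\!] : \mathcal{L} \to \mathcal{S}$ into a traced symmetric monoidal category $(\mathcal{S},\otimes,\mathsf{Tr})$, and let $H : \mathcal{S} \to \mathcal{H}$ be a verification functor (as defined in the context). Then the formal system $\mathcal{H}(\mathcal{L},[\![\cdot]\!],H)$ is sound and complete: for every block diagram $A$ of $\mathcal{L}$ with $[\![A]\!] : X \to Y$ and every $P \in H(X)$, $Q \in H(Y)$, the triple $\{P\}\,A\,\{Q\}$ is derivable in $\mathcal{H}(\mathcal{L},[\![\cdot]\!],H)$ if and only if $(P,Q) \in H([\![A]\!])$.
   Context: Hoare category: a relation $r \subseteq X \times Y$ between pre-ordered sets $(X,\sqsubseteq_X)$, $(Y,\sqsubseteq_Y)$ is monotone if $(P,Q)\in r$, $P' \sqsubseteq_X P$ and $Q \sqsubseteq_Y Q'$ imply $(P',Q')\in r$. $\mathcal{H}$ is the category of pre-ordered sets and monotone relations (composition is relational composition, $(P,R)\in s\circ r$ iff $\exists Q\,((P,Q)\in r \wedge (Q,R)\in s)$); it is a traced symmetric monoidal category with monoidal product the cartesian product of pre-orders (coordinatewise order), product of relations $r\times s = \{((P,R),(Q,S)) : (P,Q)\in r,(R,S)\in s\}$, and trace: for $r \subseteq (X\times Z)\times(Y\times Z)$, $(P,R)\in\mathsf{Tr}(r)$ iff there is $Q\in Z$ with $((P,Q),(R,Q))\in r$. Block diagram language: a set $\mathcal{L}^b$ of basic diagrams, closed under the constructors $\mathsf{Seq}(A,B)$ (sequential composition), $\mathsf{Par}(A,B)$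 (parallel composition) and $\mathsf{Fb}(A)$ (feedback). The semantics is compositional: $[\![\mathsf{Seq}(A,B)]\!] = [\![B]\!]\circ[\![A]\!]$, $[\![\mathsf{Par}(A,B)]\!] = [\![A]\!]\otimes[\![B]\!]$, $[\![\mathsf{Fb}(A)]\!] = \mathsf{Tr}([\![A]\!])$, where $\mathsf{Fb}(A)$ is formed only when $[\![A]\!] : X\otimes Z\to Y\otimes Z$, giving $\mathsf{Tr}([\![A]\!]) : X\to Y$. Verification functor: a mapping $H$ assigning to each object $X$ in the image of $[\![\cdot]\!]$ a pre-ordered set $H(X)$, with $H(X\otimes Y) = H(X)\times H(Y)$, and to each morphism $f:X\to Y$ in that image a monotone relation $H(f)\subseteq H(X)\times H(Y)$, such that for all diagrams $A,B$: $H([\![\mathsf{Seq}(A,B)]\!]) = H([\![B]\!])\circ H([\![A]\!])$, $H([\![\mathsf{Par}(A,B)]\!]) = H([\![A]\!])\times H([\![B]\!])$, and $H([\![\mathsf{Fb}(A)]\!]) = \mathsf{Tr}_{\mathcal{H}}(H([\![A]\!]))$. The system $\mathcal{H}(\mathcal{L},[\![\cdot]\!],H)$ derives triples $\{P\}A\{Q\}$ by the rules: (Ax) $\{P\}A\{Q\}$ with no premises, provided $A\in\mathcal{L}^b$ and $(P,Q)\in H([\![A]\!])$; (Con) from $\{P\}A\{Q\}$ infer $\{P'\}A\{Q'\}$ provided $P'\sqsubseteq P$ and $Q\sqsubseteq Q'$; (Par) from $\{P\}A\{Q\}$ and $\{R\}B\{S\}$ infer $\{(P,R)\}\mathsf{Par}(A,B)\{(Q,S)\}$;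 (Seq) from $\{P\}A\{Q\}$ and $\{Q\}B\{R\}$ infer $\{P\}\mathsf{Seq}(A,B)\{R\}$; (Fb) from $\{(P,Q)\}A\{(R,Q)\}$ infer $\{P\}\mathsf{Fb}(A)\{R\}$. -}

module Defs where

open import Level using (Level; _⊔_; suc)
open import Data.Product.Base using (_×_; _,_; proj₁; proj₂; ∃; ∃-syntax)
open import Data.Product.Relation.Binary.Pointwise.NonDependent using (×-preorder)
open import Function.Base using (id)
open import Function.Bundles using (_⇔_; mk⇔; module Equivalence)
open import Relation.Binary.Bundles using (Preorder)
open import Relation.Binary.Core using (Rel; REL)
open import Relation.Binary.PropositionalEquality.Core using (_≡_; sym; subst; subst₂)
open import Relation.Binary.PropositionalEquality.Properties using (subst-subst-sym)
open import Relation.Binary.Structures using (IsEquivalence)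

private
  variable
    o ℓ e b c c′ c″ ℓ₁ ℓ₂ ℓ₃ ℓ₄ ℓ₅ ℓ₆ r r′ : Level

-- Equality of morphisms is an equivalence relation on each hom-set, as is
-- usual without quotient types; equality of objects is _≡_.
record Category (o ℓ e : Level) : Set (suc (o ⊔ ℓ ⊔ e)) where
  infix  4 _≈_
  infixr 9 _∘_
  field
    Obj : Set o
    Hom : Obj → Obj → Set ℓ
    _≈_ : ∀ {X Y} → Rel (Hom X Y) e
    1[_] : ∀ X → Hom X X
    _∘_ : ∀ {X Y Z} → Hom Y Z → Hom X Y → Hom X Z
    ≈-isEquivalence : ∀ {X Y} → IsEquivalence (_≈_ {X} {Y})
    ∘-cong : ∀ {X Y Z} {f f′ : Hom Y Z} {g g′ : Hom X Y} →
             f ≈ f′ → g ≈ g′ → f ∘ g ≈ f′ ∘ g′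
    identityˡ : ∀ {X Y} {f : Hom X Y} → 1[ Y ] ∘ f ≈ f
    identityʳ : ∀ {X Y} {f : Hom X Y} → f ∘ 1[ X ] ≈ f
    assoc : ∀ {W X Y Z} {f : Hom Y Z} {g : Hom X Y} {h : Hom W X} →
            (f ∘ g) ∘ h ≈ f ∘ (g ∘ h)

record SymmetricMonoidalCategory (o ℓ e : Level) : Set (suc (o ⊔ ℓ ⊔ e)) where
  field
    category : Category o ℓ e
  open Category category public
  infixr 10 _⊗₀_ _⊗₁_
  field
    unit : Obj
    _⊗₀_ : Obj → Obj → Obj
    _⊗₁_ : ∀ {X X′ Y Y′} → Hom X Y → Hom X′ Y′ → Hom (X ⊗₀ X′) (Y ⊗₀ Y′)
    ⊗-cong : ∀ {X X′ Y Y′} {f g : Hom X Y} {f′ g′ : Hom X′ Y′} →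
             f ≈ g → f′ ≈ g′ → f ⊗₁ f′ ≈ g ⊗₁ g′
    ⊗-identity : ∀ {X Y} → 1[ X ] ⊗₁ 1[ Y ] ≈ 1[ X ⊗₀ Y ]
    ⊗-∘ : ∀ {X X′ Y Y′ Z Z′}
          {f : Hom Y Z} {f′ : Hom Y′ Z′} {g : Hom X Y} {g′ : Hom X′ Y′} →
          (f ∘ g) ⊗₁ (f′ ∘ g′) ≈ (f ⊗₁ f′) ∘ (g ⊗₁ g′)

    α⇒ : ∀ {X Y Z} → Hom ((X ⊗₀ Y) ⊗₀ Z) (X ⊗₀ (Y ⊗₀ Z))
    α⇐ : ∀ {X Y Z} → Hom (X ⊗₀ (Y ⊗₀ Z)) ((X ⊗₀ Y) ⊗₀ Z)
    α-isoˡ : ∀ {X Y Z} → α⇐ ∘ α⇒ ≈ 1[ (X ⊗₀ Y) ⊗₀ Z ]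
    α-isoʳ : ∀ {X Y Z} → α⇒ ∘ α⇐ ≈ 1[ X ⊗₀ (Y ⊗₀ Z) ]
    α-natural : ∀ {X X′ Y Y′ Z Z′} {f : Hom X X′} {g : Hom Y Y′} {h : Hom Z Z′} →
                α⇒ ∘ ((f ⊗₁ g) ⊗₁ h) ≈ (f ⊗₁ (g ⊗₁ h)) ∘ α⇒

    λ⇒ : ∀ {X} → Hom (unit ⊗₀ X) X
    λ⇐ : ∀ {X} → Hom X (unit ⊗₀ X)
    λ-isoˡ : ∀ {X} → λ⇐ ∘ λ⇒ ≈ 1[ unit ⊗₀ X ]
    λ-isoʳ : ∀ {X} → λ⇒ ∘ λ⇐ ≈ 1[ X ]
    λ-natural : ∀ {X Y} {f : Hom X Y} → λ⇒ ∘ (1[ unit ] ⊗₁ f) ≈ f ∘ λ⇒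

    ρ⇒ : ∀ {X} → Hom (X ⊗₀ unit) X
    ρ⇐ : ∀ {X} → Hom X (X ⊗₀ unit)
    ρ-isoˡ : ∀ {X} → ρ⇐ ∘ ρ⇒ ≈ 1[ X ⊗₀ unit ]
    ρ-isoʳ : ∀ {X} → ρ⇒ ∘ ρ⇐ ≈ 1[ X ]
    ρ-natural : ∀ {X Y} {f : Hom X Y} → ρ⇒ ∘ (f ⊗₁ 1[ unit ]) ≈ f ∘ ρ⇒

    σ : ∀ {X Y} → Hom (X ⊗₀ Y) (Y ⊗₀ X)
    σ-involutive : ∀ {X Y} → σ ∘ σ ≈ 1[ X ⊗₀ Y ]
    σ-natural : ∀ {X X′ Y Y′} {f : Hom X X′} {g : Hom Y Y′} →
                σ ∘ (f ⊗₁ g) ≈ (g ⊗₁ f) ∘ σ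

    triangle : ∀ {X Y} →
               (1[ X ] ⊗₁ λ⇒) ∘ α⇒ ≈ ρ⇒ ⊗₁ 1[ Y ]
    pentagon : ∀ {W X Y Z} →
               (1[ W ] ⊗₁ α⇒) ∘ α⇒ ∘ (α⇒ ⊗₁ 1[ Z ]) ≈ α⇒ {W} {X} {Y ⊗₀ Z} ∘ α⇒
    hexagon : ∀ {X Y Z} →
              (1[ Y ] ⊗₁ σ) ∘ α⇒ ∘ (σ {X} {Y} ⊗₁ 1[ Z ]) ≈ α⇒ ∘ σ ∘ α⇒

-- The axioms of Joyal, Street and Verity.
record TracedSymmetricMonoidalCategory (o ℓ e : Level) : Set (suc (o ⊔ ℓ ⊔ e)) where
  field
    symmetricMonoidalCategory : SymmetricMonoidalCategory o ℓ e
  open SymmetricMonoidalCategory symmetricMonoidalCategory public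
  field
    Tr : ∀ {X Y Z} → Hom (X ⊗₀ Z) (Y ⊗₀ Z) → Hom X Y
    Tr-cong : ∀ {X Y Z} {f g : Hom (X ⊗₀ Z) (Y ⊗₀ Z)} → f ≈ g → Tr f ≈ Tr g
    naturalˡ : ∀ {X X′ Y Z} {f : Hom (X ⊗₀ Z) (Y ⊗₀ Z)} {g : Hom X′ X} →
               Tr (f ∘ (g ⊗₁ 1[ Z ])) ≈ Tr f ∘ g
    naturalʳ : ∀ {X Y Y′ Z} {f : Hom (X ⊗₀ Z) (Y ⊗₀ Z)} {g : Hom Y Y′} →
               Tr ((g ⊗₁ 1[ Z ]) ∘ f) ≈ g ∘ Tr f
    dinatural : ∀ {X Y Z Z′} {f : Hom (X ⊗₀ Z) (Y ⊗₀ Z′)} {g : Hom Z′ Z} →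
                Tr ((1[ Y ] ⊗₁ g) ∘ f) ≈ Tr (f ∘ (1[ X ] ⊗₁ g))
    vanishing-unit : ∀ {X Y} {f : Hom (X ⊗₀ unit) (Y ⊗₀ unit)} →
                     Tr f ≈ ρ⇒ ∘ f ∘ ρ⇐
    vanishing-⊗ : ∀ {X Y Z W} {f : Hom (X ⊗₀ (Z ⊗₀ W)) (Y ⊗₀ (Z ⊗₀ W))} →
                  Tr f ≈ Tr (Tr (α⇐ ∘ f ∘ α⇒))
    superposing : ∀ {U V X Y Z} {f : Hom (X ⊗₀ Z) (Y ⊗₀ Z)} {g : Hom U V} →
                  Tr (α⇐ ∘ (g ⊗₁ f) ∘ α⇒) ≈ g ⊗₁ Tr f
    yanking : ∀ {X} → Tr σ ≈ 1[ X ]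

-- Equality of pre-ordered sets: the same carrier carrying the same relations.
-- Unlike _≡_ on the bundles it ignores the proofs of the preorder laws.
record _≐_ (X Y : Preorder c ℓ₁ ℓ₂) : Set (suc c ⊔ ℓ₁ ⊔ ℓ₂) where
  private
    module X = Preorder X
    module Y = Preorder Y
  field
    carrier≡ : X.Carrier ≡ Y.Carrier

  to : X.Carrier → Y.Carrier
  to = subst id carrier≡

  field
    ≈-agree : ∀ P Q → P X.≈ Q ⇔ to P Y.≈ to Q
    ≲-agree : ∀ P Q → P X.≲ Q ⇔ to P Y.≲ to Q

open _≐_ using (to)

≐-sym : {X Y : Preorder c ℓ₁ ℓ₂} → X ≐ Y → Y ≐ X
≐-sym {X = X} {Y = Y} X≐Y = record
  { carrier≡ = sym carrier≡
  ; ≈-agree  = λ P Q → flip Y._≈_ X._≈_ P Q (≈-agree _ _)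
  ; ≲-agree  = λ P Q → flip Y._≲_ X._≲_ P Q (≲-agree _ _)
  }
  where
  module X = Preorder X
  module Y = Preorder Y
  open _≐_ X≐Y hiding (to)

  back : Y.Carrier → X.Carrier
  back = subst id (sym carrier≡)

  flip : ∀ {a} (R : Rel Y.Carrier a) (R′ : Rel X.Carrier a) → ∀ P Q →
         R′ (back P) (back Q) ⇔ R (subst id carrier≡ (back P)) (subst id carrier≡ (back Q)) →
         R P Q ⇔ R′ (back P) (back Q)
  flip R R′ P Q eq = mk⇔
    (λ p → Equivalence.from eq (subst₂ R (sym (subst-subst-sym carrier≡))
                                         (sym (subst-subst-sym carrier≡)) p))
    (λ p → subst₂ R (subst-subst-sym carrier≡) (subst-subst-sym carrier≡)
                    (Equivalence.to eq p))

record MonotoneRelation (X : Preorder c ℓ₁ ℓ₂) (Y : Preorder c′ ℓ₃ ℓ₄) (r : Level)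
       : Set (c ⊔ ℓ₂ ⊔ c′ ⊔ ℓ₄ ⊔ suc r) where
  private
    module X = Preorder X
    module Y = Preorder Y
  field
    rel : REL X.Carrier Y.Carrier r
    monotone : ∀ {P P′ Q Q′} → rel P Q → P′ X.≲ P → Q Y.≲ Q′ → rel P′ Q′

open MonotoneRelation public using (rel)

infix 4 _≋_
_≋_ : {X : Preorder c ℓ₁ ℓ₂} {Y : Preorder c′ ℓ₃ ℓ₄} →
      MonotoneRelation X Y r → MonotoneRelation X Y r′ → Set _
R ≋ S = ∀ P Q → rel R P Q ⇔ rel S P Q

along : {X X′ : Preorder c ℓ₁ ℓ₂} {Y Y′ : Preorder c′ ℓ₃ ℓ₄} →
        X′ ≐ X → Y′ ≐ Y → MonotoneRelation X Y r → MonotoneRelation X′ Y′ r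
along X′≐X Y′≐Y R = record
  { rel      = λ P Q → rel R (to X′≐X P) (to Y′≐Y Q)
  ; monotone = λ PQ∈R P′≲P Q≲Q′ → MonotoneRelation.monotone R PQ∈R
                 (Equivalence.to (_≐_.≲-agree X′≐X _ _) P′≲P)
                 (Equivalence.to (_≐_.≲-agree Y′≐Y _ _) Q≲Q′)
  }

-- Composition, monoidal product and trace of the category of pre-ordered sets
-- and monotone relations; its product of objects is ×-preorder.
infixr 9 _∘ᴴ_
_∘ᴴ_ : {X : Preorder c ℓ₁ ℓ₂} {Y : Preorder c′ ℓ₃ ℓ₄} {Z : Preorder c″ ℓ₅ ℓ₆} →
       MonotoneRelation Y Z r → MonotoneRelation X Y r′ →
       MonotoneRelation X Z (c′ ⊔ r ⊔ r′)
_∘ᴴ_ {X = X} {Y = Y} {Z = Z} S R = record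
  { rel      = λ P T → ∃[ Q ] (rel R P Q × rel S Q T)
  ; monotone = λ { (Q , PQ∈R , QT∈S) P′≲P T≲T′ →
                   Q , MonotoneRelation.monotone R PQ∈R P′≲P (Preorder.refl Y)
                     , MonotoneRelation.monotone S QT∈S (Preorder.refl Y) T≲T′ }
  }

infixr 10 _×ᴴ_
_×ᴴ_ : {X X′ : Preorder c ℓ₁ ℓ₂} {Y Y′ : Preorder c′ ℓ₃ ℓ₄} →
       MonotoneRelation X Y r → MonotoneRelation X′ Y′ r′ →
       MonotoneRelation (×-preorder X X′) (×-preorder Y Y′) (r ⊔ r′)
R ×ᴴ S = record
  { rel      = λ { (P , P′) (Q , Q′) → rel R P Q × rel S P′ Q′ }
  ; monotone = λ { (p , q) (a , a′) (d , d′) →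
                   MonotoneRelation.monotone R p a d ,
                   MonotoneRelation.monotone S q a′ d′ }
  }

Trᴴ : {X : Preorder c ℓ₁ ℓ₂} {Y : Preorder c′ ℓ₃ ℓ₄} {Z : Preorder c″ ℓ₅ ℓ₆} →
      MonotoneRelation (×-preorder X Z) (×-preorder Y Z) r →
      MonotoneRelation X Y (c″ ⊔ r)
Trᴴ {Z = Z} R = record
  { rel      = λ P T → ∃[ Q ] rel R (P , Q) (T , Q)
  ; monotone = λ { (Q , p) P′≲P T≲T′ →
                   Q , MonotoneRelation.monotone R p (P′≲P , Preorder.refl Z)
                                                     (T≲T′ , Preorder.refl Z) }
  }

record BlockDiagramLanguage (S : TracedSymmetricMonoidalCategory o ℓ e) (b : Level)
       : Set (o ⊔ ℓ ⊔ suc b) where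
  open TracedSymmetricMonoidalCategory S
  field
    Basic : Obj → Obj → Set b
    ⟦_⟧ᵇ : ∀ {X Y} → Basic X Y → Hom X Y

  -- Diagram X Y is the set of diagrams A with ⟦ A ⟧ : X → Y; the indices impose
  -- the side conditions under which Seq and Fb may be formed.
  data Diagram : Obj → Obj → Set (o ⊔ b) where
    basic : ∀ {X Y} → Basic X Y → Diagram X Y
    Seq   : ∀ {X Y Z} → Diagram X Y → Diagram Y Z → Diagram X Z
    Par   : ∀ {X X′ Y Y′} → Diagram X Y → Diagram X′ Y′ → Diagram (X ⊗₀ X′) (Y ⊗₀ Y′)
    Fb    : ∀ {X Y Z} → Diagram (X ⊗₀ Z) (Y ⊗₀ Z) → Diagram X Y

  ⟦_⟧ : ∀ {X Y} → Diagram X Y → Hom X Y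
  ⟦ basic a ⟧ = ⟦ a ⟧ᵇ
  ⟦ Seq A B ⟧ = ⟦ B ⟧ ∘ ⟦ A ⟧
  ⟦ Par A B ⟧ = ⟦ A ⟧ ⊗₁ ⟦ B ⟧
  ⟦ Fb A ⟧    = Tr ⟦ A ⟧

  MorphismInImage : ∀ {X Y} → Hom X Y → Set (o ⊔ e ⊔ b)
  MorphismInImage {X} {Y} f = ∃ λ (A : Diagram X Y) → ⟦ A ⟧ ≈ f

  -- The image is closed under tensor factors, so that H (X ⊗ Y) = H X × H Y makes
  -- sense whenever X ⊗ Y is in the image.  In particular it contains the feedback
  -- object Z of Fb, which need not be the source or target of any diagram.
  data ObjectInImage : Obj → Set (o ⊔ b) where
    source : ∀ {X Y} → Diagram X Y → ObjectInImage X
    target : ∀ {X Y} → Diagram X Y → ObjectInImage Y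
    left   : ∀ {X Y} → ObjectInImage (X ⊗₀ Y) → ObjectInImage X
    right  : ∀ {X Y} → ObjectInImage (X ⊗₀ Y) → ObjectInImage Y

-- H is defined on the image only.  Membership proofs are irrelevant arguments, so
-- the values of H depend on the object or morphism and not on why it is in the image.
record VerificationFunctor {S : TracedSymmetricMonoidalCategory o ℓ e}
                           (L : BlockDiagramLanguage S b) (c ℓ₁ ℓ₂ r : Level)
       : Set (o ⊔ ℓ ⊔ e ⊔ b ⊔ suc (c ⊔ ℓ₁ ⊔ ℓ₂ ⊔ r)) where
  open TracedSymmetricMonoidalCategory S
  open BlockDiagramLanguage L
  field
    H₀ : ∀ X → .(ObjectInImage X) → Preorder c ℓ₁ ℓ₂
    H₀-⊗ : ∀ {X Y} .(i : ObjectInImage (X ⊗₀ Y)) →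
           H₀ (X ⊗₀ Y) i ≐ ×-preorder (H₀ X (left i)) (H₀ Y (right i))
    H₁ : ∀ {X Y} (f : Hom X Y) .(i : MorphismInImage f) →
         MonotoneRelation (H₀ X (source (proj₁ i))) (H₀ Y (target (proj₁ i))) r
    H₁-cong : ∀ {X Y} {f g : Hom X Y} .(i : MorphismInImage f) .(j : MorphismInImage g) →
              f ≈ g → H₁ f i ≋ H₁ g j

  H⟦_⟧ : ∀ {X Y} (A : Diagram X Y) →
         MonotoneRelation (H₀ X (source A)) (H₀ Y (target A)) r
  H⟦ A ⟧ = H₁ ⟦ A ⟧ (A , IsEquivalence.refl ≈-isEquivalence)

  field
    H-Seq : ∀ {X Y Z} (A : Diagram X Y) (B : Diagram Y Z) →
            H⟦ Seq A B ⟧ ≋ H⟦ B ⟧ ∘ᴴ H⟦ A ⟧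
    H-Par : ∀ {X X′ Y Y′} (A : Diagram X Y) (B : Diagram X′ Y′) →
            H⟦ Par A B ⟧ ≋
            along (H₀-⊗ (source (Par A B))) (H₀-⊗ (target (Par A B))) (H⟦ A ⟧ ×ᴴ H⟦ B ⟧)
    H-Fb : ∀ {X Y Z} (A : Diagram (X ⊗₀ Z) (Y ⊗₀ Z)) →
           H⟦ Fb A ⟧ ≋
           Trᴴ (along (≐-sym (H₀-⊗ (source A))) (≐-sym (H₀-⊗ (target A))) H⟦ A ⟧)

  Source : ∀ {X Y} → Diagram X Y → Set c
  Source {X} A = Preorder.Carrier (H₀ X (source A))

  Target : ∀ {X Y} → Diagram X Y → Set c
  Target {Y = Y} A = Preorder.Carrier (H₀ Y (target A))

module HoareSystem {S : TracedSymmetricMonoidalCategory o ℓ e} {L : BlockDiagramLanguage S b}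
                   (H : VerificationFunctor L c ℓ₁ ℓ₂ r) where
  open TracedSymmetricMonoidalCategory S
  open BlockDiagramLanguage L
  open VerificationFunctor H

  -- (P , Q) regarded as an element of H (X ⊗ Y).
  pair : ∀ {X Y} .(i : ObjectInImage (X ⊗₀ Y)) →
         Preorder.Carrier (H₀ X (left i)) → Preorder.Carrier (H₀ Y (right i)) →
         Preorder.Carrier (H₀ (X ⊗₀ Y) i)
  pair i P Q = to (≐-sym (H₀-⊗ i)) (P , Q)

  -- Triple A P Q is the set of derivations of {P} A {Q}.
  data Triple : ∀ {X Y} (A : Diagram X Y) → Source A → Target A →
                Set (o ⊔ b ⊔ c ⊔ ℓ₂ ⊔ r) where
    ax  : ∀ {X Y} (a : Basic X Y) {P Q} →
          rel H⟦ basic a ⟧ P Q →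
          Triple (basic a) P Q
    con : ∀ {X Y} {A : Diagram X Y} {P P′ Q Q′} →
          Preorder._≲_ (H₀ X (source A)) P′ P →
          Preorder._≲_ (H₀ Y (target A)) Q Q′ →
          Triple A P Q →
          Triple A P′ Q′
    par : ∀ {X X′ Y Y′} {A : Diagram X Y} {B : Diagram X′ Y′} {P Q R S} →
          Triple A P Q →
          Triple B R S →
          Triple (Par A B) (pair (source (Par A B)) P R) (pair (target (Par A B)) Q S)
    seq : ∀ {X Y Z} {A : Diagram X Y} {B : Diagram Y Z} {P Q R} →
          Triple A P Q →
          Triple B Q R →
          Triple (Seq A B) P R
    fb  : ∀ {X Y Z} {A : Diagram (X ⊗₀ Z) (Y ⊗₀ Z)} {P Q R} →
          Triple A (pair (source A) P Q) (pair (target A) R Q) →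
          Triple (Fb A) P R

{-# OPTIONS --safe #-}
module Submission where

open import Defs
open import Data.Product.Base using (_,_)
open import Function.Bundles using (_⇔_; mk⇔; module Equivalence)
open import Level using (Level)
open import Relation.Binary.Bundles using (Preorder)
open import Relation.Binary.PropositionalEquality using (_≡_; sym; subst₂)
open import Relation.Binary.PropositionalEquality.Properties
  using (subst-subst-sym; subst-sym-subst)

-- Each rule mirrors a clause of the compositional semantics: `seq`, `par` and `fb` describe how a
-- pair arises in a composite, product or trace of relations, and `H` sends each diagram constructor
-- to that operation. `sound` uses these equivalences by induction on derivations, with monotonicity
-- covering `con`; `complete` reverses them by induction on diagrams.

private
  variable
    o ℓ e b c ℓ₁ ℓ₂ r : Level

module _ {X Y : Preorder c ℓ₁ ℓ₂} (X≐Y : X ≐ Y) where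
  open _≐_

  -- Tensors become products only up to `≐`. Here the `to` inside `along` cancels the one inside
  -- `pair`, so that `H-Par` applies to the conclusion of `par`.
  to-from : ∀ Q → to X≐Y (to (≐-sym X≐Y) Q) ≡ Q
  to-from Q = subst-subst-sym (carrier≡ X≐Y)

  -- Makes every element of `H₀ (X ⊗₀ Y)` a `pair` of its components, the form in which `par`
  -- concludes.
  from-to : ∀ P → to (≐-sym X≐Y) (to X≐Y P) ≡ P
  from-to P = subst-sym-subst (carrier≡ X≐Y)

module _ {S : TracedSymmetricMonoidalCategory o ℓ e} {L : BlockDiagramLanguage S b}
         (H : VerificationFunctor L c ℓ₁ ℓ₂ r) where
  open BlockDiagramLanguage L
  open VerificationFunctor H
  open HoareSystem H
  open Equivalence using () renaming (to to ⇒; from to ⇐)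

  sound : ∀ {X Y} {A : Diagram X Y} {P Q} → Triple A P Q → rel H⟦ A ⟧ P Q
  sound (ax a PQ∈a) = PQ∈a
  sound {A = A} (con P′≲P Q≲Q′ t) = MonotoneRelation.monotone H⟦ A ⟧ (sound t) P′≲P Q≲Q′
  sound (par {A = A} {B = B} t u) =
    ⇐ (H-Par A B _ _)
      (subst₂ (rel (H⟦ A ⟧ ×ᴴ H⟦ B ⟧))
              (sym (to-from (H₀-⊗ (source (Par A B))) _))
              (sym (to-from (H₀-⊗ (target (Par A B))) _))
              (sound t , sound u))
  sound (seq {A = A} {B = B} t u) = ⇐ (H-Seq A B _ _) (_ , sound t , sound u)
  -- No transport: `H-Fb` and `pair` embed pairs by the same `≐-sym`.
  sound (fb {A = A} t) = ⇐ (H-Fb A _ _) (_ , sound t)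

  complete : ∀ {X Y} (A : Diagram X Y) {P Q} → rel H⟦ A ⟧ P Q → Triple A P Q
  complete (basic a) PQ∈a = ax a PQ∈a
  complete (Seq A B) PR∈AB with ⇒ (H-Seq A B _ _) PR∈AB
  -- The witness of relational composition is the intermediate assertion.
  ... | _ , PQ∈A , QR∈B = seq (complete A PQ∈A) (complete B QR∈B)
  complete (Par A B) PQ∈AB with ⇒ (H-Par A B _ _) PQ∈AB
  ... | PQ∈A , RS∈B =
    subst₂ (Triple (Par A B))
           (from-to (H₀-⊗ (source (Par A B))) _)
           (from-to (H₀-⊗ (target (Par A B))) _)
           (par (complete A PQ∈A) (complete B RS∈B))
  complete (Fb A) PR∈FbA with ⇒ (H-Fb A _ _) PR∈FbA
  -- The trace witness is the invariant on the feedback wire.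
  ... | _ , PQRQ∈A = fb (complete A PQRQ∈A)

theorem3p4 : ∀ {o ℓ e b c ℓ₁ ℓ₂ r}
    {S : TracedSymmetricMonoidalCategory o ℓ e}
    (L : BlockDiagramLanguage S b)
    (H : VerificationFunctor L c ℓ₁ ℓ₂ r)
    {X Y : TracedSymmetricMonoidalCategory.Obj S}
    (A : BlockDiagramLanguage.Diagram L X Y)
    (P : VerificationFunctor.Source H A)
    (Q : VerificationFunctor.Target H A) →
    HoareSystem.Triple H A P Q ⇔ rel (VerificationFunctor.H⟦_⟧ H A) P Q
theorem3p4 L H A P Q = mk⇔ (sound H) (complete H A)
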